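{- For all non-negative integers $n$, $p$ and $m$, $$\sum_{k=0}^n\frac{1}{2^{2k}}\binom{2(k+p)}{k+p}\binom{k+p}{k}H_{n-k}(m)\left(O_{k+p}-O_p\right)=\frac12\sum_{k=0}^n\frac{1}{2^{2k}}\binom{2(k+p)}{k+p}\binom{k+p}{k}H_{n-k}(m+1).$$ In particular, $$\sum_{k=0}^n\frac{1}{2^{2k}}\binom{2(k+p)}{k+p}\binom{k+p}{k}H_{n-k}=\frac{1}{2^{2n}}\,\frac{p+1}{2p+1}\binom{2(n+p+1)}{n+p+1}\binom{n+p+1}{n}\left(O_{n+p+1}-O_{p+1}\right).$$
   Context: For integers $m\ge 1$, $n\ge 0$, the multiple harmonic-like numbers are $H_n(m)=\sum_{1\le k_1+k_2+\cdots+k_m\le n}\frac{1}{k_1k_2\cdots k_m}$ (sum over positive integers $k_1,\dots,k_m$), with $H_n(0)=1$ for $n\ge 0$ and $H_0(m)=0$ for $m\ge1$. $H_n=\sum_{k=1}^n\frac1k$. The odd harmonic numbers are $O_n=\sum_{k=1}^n\frac{1}{2k-1}$, $O_0=0$. -}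

module Defs where

open import Data.Nat.Base as ℕ using (ℕ; zero; suc)
open import Data.Nat.Properties using (_≤?_; m^n≢0)
open import Data.Integer.Base using (+_)
open import Data.Rational.Base using (ℚ; 0ℚ; 1ℚ; _+_; _*_; _/_)
open import Data.List.Base using (List; []; _∷_; map; foldr; upTo; filter; cartesianProductWith)
open import Data.Vec.Base as Vec using (Vec)
open import Relation.Nullary.Decidable using (_×-dec_)

fromℕ : ℕ → ℚ
fromℕ n = + n / 1

sumOver : {A : Set} → List A → (A → ℚ) → ℚ
sumOver xs f = foldr _+_ 0ℚ (map f xs)

-- Σ_{k=0}^{n} f k, both ends included.
∑₀ : ℕ → (ℕ → ℚ) → ℚ
∑₀ n f = sumOver (upTo (suc n)) f

syntax ∑₀ n (λ k → e) = ∑[0≤ k ≤ n ] e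

1/2^_ : ℕ → ℚ
1/2^ e = (+ 1 / (2 ℕ.^ e)) {{m^n≢0 2 e}}

-- From here on a positive integer k is represented by its
-- predecessor j, i.e. k = suc j, so that 1/k needs no convention at 0.

harmonic : ℕ → ℚ
harmonic n = sumOver (upTo n) λ j → + 1 / suc j

-- 2k - 1 = 2j + 1 for k = j + 1.
O : ℕ → ℚ
O n = sumOver (upTo n) λ j → + 1 / suc (2 ℕ.* j)

tuples : {A : Set} (m : ℕ) → List A → List (Vec A m)
tuples zero    xs = Vec.[] ∷ []
tuples (suc m) xs = cartesianProductWith Vec._∷_ xs (tuples m xs)

tupleSum : {m : ℕ} → Vec ℕ m → ℕ
tupleSum js = Vec.sum (Vec.map suc js)

tupleRecip : {m : ℕ} → Vec ℕ m → ℚ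
tupleRecip js = Vec.foldr′ _*_ 1ℚ (Vec.map (λ j → + 1 / suc j) js)

-- H n m is H_n(m).  Every (k₁,…,k_m) of positive integers with
-- k₁+⋯+k_m ≤ n lies in {1,…,n}^m, so it suffices to filter that box.
H : ℕ → ℕ → ℚ
H n zero      = 1ℚ
H n m@(suc _) =
  sumOver (filter (λ js → (1 ≤? tupleSum js) ×-dec (tupleSum js ≤? n))
                  (tuples m (upTo n)))
          tupleRecip

{-# OPTIONS --safe #-}
module Submission where

-- With L = -log(1 - z), the generating function of H_n(m) in n is
-- L^m / (1 - z), and that of the weights a_k is
-- F = binom(2p, p) (1 - z)^(-p - 1/2).  Differentiating F in the exponent
-- suggests that a_k (O_{k+p} - O_p) has generating function F L / 2; this is
-- verified by comparing first-order recurrences, and the first identity is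
-- then associativity of the Cauchy product.  For m = 0 the left-hand side
-- telescopes, because F / (1 - z) is a multiple of the same series with p + 1
-- in place of p; this gives the second identity.

open import Defs
open import Data.Nat.Base as ℕ using (ℕ; zero; suc; _∸_)
import Data.Nat.Properties as ℕ
open import Data.Nat.Combinatorics using (_C_; nCk≡nC[n∸k]; nCn≡1; nC1≡n; nCk+nC[k+1]≡[n+1]C[k+1])
open import Data.Integer.Base as ℤ using (+_)
import Data.Integer.Properties as ℤ
open import Data.List.Base using ([]; _∷_; _++_; map; foldr; upTo; filter; cartesianProductWith)
open import Data.List.Properties using (map-applyUpTo; filter-++; filter-≐; filter-none)
open import Data.List.Relation.Unary.All using (universal)
open import Data.Rational.Base using (ℚ; 0ℚ; 1ℚ; ½; _+_; _-_; _*_; _/_; toℚᵘ; fromℚᵘ)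
open import Data.Rational.Properties
open import Data.Rational.Solver using (module +-*-Solver)
open import Data.Rational.Unnormalised.Base as ℚᵘ using (mkℚᵘ; *≡*)
import Data.Rational.Unnormalised.Properties as ℚᵘ
open import Data.Product.Base using (_×_; _,_; proj₂)
open import Data.Vec.Base as Vec using (Vec)
open import Function.Base using (_∘_; id)
open import Relation.Binary.PropositionalEquality.Core using (_≡_; _≗_; refl; sym; trans; cong; cong₂; subst)
open import Relation.Binary.PropositionalEquality.Properties using (module ≡-Reasoning)
open import Relation.Nullary.Decidable using (does; _×-dec_)
open import Data.Bool.Base using (true; false)
open import Relation.Unary using (Pred; Decidable)
open import Level using (0ℓ)

open +-*-Solver

-- Rational arithmetic

-- `i / suc d` unfolds to `fromℚᵘ (mkℚᵘ i d)`, so these two laws reduce facts about fractions to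
-- integer identities, away from the gcd normalisation in `_/_`.
fromℚᵘ-homo-+ : ∀ x y → fromℚᵘ (x ℚᵘ.+ y) ≡ fromℚᵘ x + fromℚᵘ y
fromℚᵘ-homo-+ x y = toℚᵘ-injective (begin
  toℚᵘ (fromℚᵘ (x ℚᵘ.+ y))                  ≈⟨ toℚᵘ-fromℚᵘ (x ℚᵘ.+ y) ⟩
  x ℚᵘ.+ y                                  ≈⟨ ℚᵘ.+-cong (toℚᵘ-fromℚᵘ x) (toℚᵘ-fromℚᵘ y) ⟨
  toℚᵘ (fromℚᵘ x) ℚᵘ.+ toℚᵘ (fromℚᵘ y)      ≈⟨ toℚᵘ-homo-+ (fromℚᵘ x) (fromℚᵘ y) ⟨
  toℚᵘ (fromℚᵘ x + fromℚᵘ y)                ∎)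
  where open ℚᵘ.≃-Reasoning

fromℚᵘ-homo-* : ∀ x y → fromℚᵘ (x ℚᵘ.* y) ≡ fromℚᵘ x * fromℚᵘ y
fromℚᵘ-homo-* x y = toℚᵘ-injective (begin
  toℚᵘ (fromℚᵘ (x ℚᵘ.* y))                  ≈⟨ toℚᵘ-fromℚᵘ (x ℚᵘ.* y) ⟩
  x ℚᵘ.* y                                  ≈⟨ ℚᵘ.*-cong (toℚᵘ-fromℚᵘ x) (toℚᵘ-fromℚᵘ y) ⟨
  toℚᵘ (fromℚᵘ x) ℚᵘ.* toℚᵘ (fromℚᵘ y)      ≈⟨ toℚᵘ-homo-* (fromℚᵘ x) (fromℚᵘ y) ⟨
  toℚᵘ (fromℚᵘ x * fromℚᵘ y)                ∎)
  where open ℚᵘ.≃-Reasoning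

fromℕ-homo-+ : ∀ m n → fromℕ (m ℕ.+ n) ≡ fromℕ m + fromℕ n
fromℕ-homo-+ m n = trans
  (cong (λ i → i / 1) (sym (cong₂ ℤ._+_ (ℤ.*-identityʳ (+ m)) (ℤ.*-identityʳ (+ n)))))
  (fromℚᵘ-homo-+ (mkℚᵘ (+ m) 0) (mkℚᵘ (+ n) 0))

fromℕ-homo-* : ∀ m n → fromℕ (m ℕ.* n) ≡ fromℕ m * fromℕ n
fromℕ-homo-* m n = trans
  (cong (λ i → i / 1) (ℤ.pos-* m n))
  (fromℚᵘ-homo-* (mkℚᵘ (+ m) 0) (mkℚᵘ (+ n) 0))

fromℕ-suc : ∀ n → fromℕ (suc n) ≡ 1ℚ + fromℕ n
fromℕ-suc = fromℕ-homo-+ 1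

recip : ℕ → ℚ
recip d = + 1 / suc d

/-recip : ∀ i d → (i / suc d) ≡ (i / 1) * recip d
/-recip i d = trans
  (fromℚᵘ-cong {mkℚᵘ i d} {mkℚᵘ i 0 ℚᵘ.* mkℚᵘ (+ 1) d}
    (*≡* (cong₂ ℤ._*_ (sym (ℤ.*-identityʳ i)) (cong (λ e → + suc e) (ℕ.+-identityʳ d)))))
  (fromℚᵘ-homo-* (mkℚᵘ i 0) (mkℚᵘ (+ 1) d))

recip-inverse : ∀ d → fromℕ (suc d) * recip d ≡ 1ℚ
recip-inverse d = trans (sym (/-recip (+ suc d) d))
  (fromℚᵘ-cong {mkℚᵘ (+ suc d) d} {mkℚᵘ (+ 1) 0} (*≡* (ℤ.*-comm (+ suc d) (+ 1))))

fromℕ-cancelˡ : ∀ d {x y} → fromℕ (suc d) * x ≡ fromℕ (suc d) * y → x ≡ y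
fromℕ-cancelˡ d {x} {y} eq = trans (sym (undo x)) (trans (cong (recip d *_) eq) (undo y))
  where
  undo : ∀ z → recip d * (fromℕ (suc d) * z) ≡ z
  undo z = trans (solve 3 (λ r s z → r :* (s :* z) := (s :* r) :* z) refl (recip d) (fromℕ (suc d)) z)
    (trans (cong (_* z) (recip-inverse d)) (*-identityˡ z))

1/2^-suc : ∀ e → 1/2^ (suc e) ≡ ½ * 1/2^ e
-- The power is generalised to a variable `d`, so that matching on `suc d` lets both fractions
-- unfold.
1/2^-suc e = helper (2 ℕ.^ e) {{ℕ.m^n≢0 2 e}} {{ℕ.m^n≢0 2 (suc e)}}
  where
  helper : ∀ d .{{_ : ℕ.NonZero d}} .{{_ : ℕ.NonZero (2 ℕ.* d)}} → (+ 1 / (2 ℕ.* d)) ≡ ½ * (+ 1 / d)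
  helper (suc d) = fromℚᵘ-homo-* (mkℚᵘ (+ 1) 1) (mkℚᵘ (+ 1) d)

-- Binomial coefficients

nC0≡1 : ∀ n → n C 0 ≡ 1
nC0≡1 n = trans (nCk≡nC[n∸k] {0} {n} ℕ.z≤n) (nCn≡1 n)

-- Pascal's rule splits the left side, the two induction hypotheses share the factor `suc n`, and
-- Pascal's rule reassembles what that factor multiplies.
absorption : ∀ n k → suc k ℕ.* (suc n C suc k) ≡ suc n ℕ.* (n C k)
absorption n zero = begin
  1 ℕ.* (suc n C 1)  ≡⟨ ℕ.*-identityˡ _ ⟩
  suc n C 1          ≡⟨ nC1≡n (suc n) ⟩
  suc n              ≡⟨ ℕ.*-identityʳ (suc n) ⟨
  suc n ℕ.* 1        ≡⟨ cong (suc n ℕ.*_) (nC0≡1 n) ⟨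
  suc n ℕ.* (n C 0)  ∎
  where open ≡-Reasoning
absorption zero    (suc k) = ℕ.*-zeroʳ (suc (suc k))
absorption (suc n) (suc k) = begin
  suc (suc k) ℕ.* (suc (suc n) C suc (suc k))
    ≡⟨ cong (suc (suc k) ℕ.*_) (nCk+nC[k+1]≡[n+1]C[k+1] (suc n) (suc k)) ⟨
  suc (suc k) ℕ.* (x ℕ.+ (suc n C suc (suc k)))
    ≡⟨ ℕ.*-distribˡ-+ (suc (suc k)) x _ ⟩
  (x ℕ.+ suc k ℕ.* x) ℕ.+ suc (suc k) ℕ.* (suc n C suc (suc k))
    ≡⟨ cong₂ (λ a b → (x ℕ.+ a) ℕ.+ b) (absorption n k) (absorption n (suc k)) ⟩
  (x ℕ.+ suc n ℕ.* (n C k)) ℕ.+ suc n ℕ.* (n C suc k)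
    ≡⟨ ℕ.+-assoc x _ _ ⟩
  x ℕ.+ (suc n ℕ.* (n C k) ℕ.+ suc n ℕ.* (n C suc k))
    ≡⟨ cong (x ℕ.+_) (ℕ.*-distribˡ-+ (suc n) (n C k) _) ⟨
  x ℕ.+ suc n ℕ.* ((n C k) ℕ.+ (n C suc k))
    ≡⟨ cong (λ a → x ℕ.+ suc n ℕ.* a) (nCk+nC[k+1]≡[n+1]C[k+1] n k) ⟩
  suc (suc n) ℕ.* x ∎
  where
  open ≡-Reasoning
  x = suc n C suc k

C-symmetric : ∀ k p → (k ℕ.+ p) C k ≡ (k ℕ.+ p) C p
C-symmetric k p = trans (nCk≡nC[n∸k] (ℕ.m≤m+n k p)) (cong ((k ℕ.+ p) C_) (ℕ.m+n∸m≡n k p))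

-- Symmetry turns the lower index into `suc p`, where absorption applies. It serves recurrences in
-- `p`, as `absorption` serves those in `k`.
absorption-lower : ∀ k p → suc p ℕ.* ((k ℕ.+ suc p) C k) ≡ suc (k ℕ.+ p) ℕ.* ((k ℕ.+ p) C k)
absorption-lower k p = begin
  suc p ℕ.* ((k ℕ.+ suc p) C k)        ≡⟨ cong (suc p ℕ.*_) (C-symmetric k (suc p)) ⟩
  suc p ℕ.* ((k ℕ.+ suc p) C suc p)    ≡⟨ cong (λ N → suc p ℕ.* (N C suc p)) (ℕ.+-suc k p) ⟩
  suc p ℕ.* (suc (k ℕ.+ p) C suc p)    ≡⟨ absorption (k ℕ.+ p) p ⟩
  suc (k ℕ.+ p) ℕ.* ((k ℕ.+ p) C p)    ≡⟨ cong (suc (k ℕ.+ p) ℕ.*_) (C-symmetric k p) ⟨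
  suc (k ℕ.+ p) ℕ.* ((k ℕ.+ p) C k)    ∎
  where open ≡-Reasoning

central : ℕ → ℕ
central n = (2 ℕ.* n) C n

-- Two absorptions lower C(2n+2, n+1) to C(2n+1, n) and then to C(2n, n), the second with both
-- parameters equal to `n`.
central-suc : ∀ n → suc n ℕ.* central (suc n) ≡ 2 ℕ.* (suc (2 ℕ.* n) ℕ.* central n)
central-suc n = begin
  suc n ℕ.* ((2 ℕ.* suc n) C suc n)
    ≡⟨ cong (λ N → suc n ℕ.* (N C suc n)) double ⟩
  suc n ℕ.* (suc (n ℕ.+ suc n) C suc n)
    ≡⟨ absorption (n ℕ.+ suc n) n ⟩
  suc (n ℕ.+ suc n) ℕ.* ((n ℕ.+ suc n) C n)
    ≡⟨ cong (ℕ._* ((n ℕ.+ suc n) C n)) (sym double) ⟩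
  (2 ℕ.* suc n) ℕ.* ((n ℕ.+ suc n) C n)
    ≡⟨ ℕ.*-assoc 2 (suc n) _ ⟩
  2 ℕ.* (suc n ℕ.* ((n ℕ.+ suc n) C n))
    ≡⟨ cong (2 ℕ.*_) (absorption-lower n n) ⟩
  2 ℕ.* (suc (n ℕ.+ n) ℕ.* ((n ℕ.+ n) C n))
    ≡⟨ cong (λ N → 2 ℕ.* (suc N ℕ.* (N C n))) (cong (n ℕ.+_) (ℕ.+-identityʳ n)) ⟨
  2 ℕ.* (suc (2 ℕ.* n) ℕ.* central n) ∎
  where
  open ≡-Reasoning
  double : 2 ℕ.* suc n ≡ suc (n ℕ.+ suc n)
  double = cong (suc n ℕ.+_) (ℕ.+-identityʳ (suc n))

-- Finite sums

sumOver-cong : ∀ {A : Set} {f g : A → ℚ} → f ≗ g → ∀ xs → sumOver xs f ≡ sumOver xs g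
sumOver-cong f≗g []       = refl
sumOver-cong f≗g (x ∷ xs) = cong₂ _+_ (f≗g x) (sumOver-cong f≗g xs)

sumOver-++ : ∀ {A : Set} (f : A → ℚ) xs ys → sumOver (xs ++ ys) f ≡ sumOver xs f + sumOver ys f
sumOver-++ f []       ys = sym (+-identityˡ _)
sumOver-++ f (x ∷ xs) ys = trans (cong (λ s → f x + s) (sumOver-++ f xs ys)) (sym (+-assoc (f x) _ _))

sumOver-upTo-suc : ∀ n (f : ℕ → ℚ) → sumOver (upTo (suc n)) f ≡ f 0 + sumOver (upTo n) (f ∘ suc)
sumOver-upTo-suc n f = cong (λ ys → f 0 + foldr _+_ 0ℚ ys)
  (trans (map-applyUpTo suc f n) (sym (map-applyUpTo id (f ∘ suc) n)))

sumOver-upTo-last : ∀ n (f : ℕ → ℚ) → sumOver (upTo (suc n)) f ≡ sumOver (upTo n) f + f n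
sumOver-upTo-last zero    f = +-comm (f 0) 0ℚ
sumOver-upTo-last (suc n) f = begin
  sumOver (upTo (suc (suc n))) f                    ≡⟨ sumOver-upTo-suc (suc n) f ⟩
  f 0 + sumOver (upTo (suc n)) (f ∘ suc)            ≡⟨ cong (λ s → f 0 + s) (sumOver-upTo-last n (f ∘ suc)) ⟩
  f 0 + (sumOver (upTo n) (f ∘ suc) + f (suc n))    ≡⟨ +-assoc (f 0) _ _ ⟨
  f 0 + sumOver (upTo n) (f ∘ suc) + f (suc n)      ≡⟨ cong (_+ f (suc n)) (sumOver-upTo-suc n f) ⟨
  sumOver (upTo (suc n)) f + f (suc n)              ∎
  where open ≡-Reasoning

-- Cauchy products

infixl 7 _⊛_

-- Recursion on the index, shifting the left factor, keeps truncated subtraction out of the algebra;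
-- `⊛-∑` is the bridge to sums in `n ∸ k`.
_⊛_ : (ℕ → ℚ) → (ℕ → ℚ) → ℕ → ℚ
(f ⊛ g) zero    = f 0 * g 0
(f ⊛ g) (suc n) = f 0 * g (suc n) + ((f ∘ suc) ⊛ g) n

⊛-∑ : ∀ f g n → ∑[0≤ k ≤ n ] (f k * g (n ∸ k)) ≡ (f ⊛ g) n
⊛-∑ f g zero    = +-identityʳ _
⊛-∑ f g (suc n) = trans (sumOver-upTo-suc (suc n) (λ k → f k * g (suc n ∸ k)))
  (cong (λ s → f 0 * g (suc n) + s) (⊛-∑ (f ∘ suc) g n))

⊛-cong : ∀ {f f′ g g′} → f ≗ f′ → g ≗ g′ → f ⊛ g ≗ f′ ⊛ g′
⊛-cong p q zero    = cong₂ _*_ (p 0) (q 0)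
⊛-cong p q (suc n) = cong₂ _+_ (cong₂ _*_ (p 0) (q (suc n))) (⊛-cong (p ∘ suc) q n)

-- The shape `c * f k + f′ k` is that of `(f ⊛ g) (suc k)` after unfolding, which is what
-- associativity meets; the recurrences for `θ` have it too.
⊛-linearˡ : ∀ c f f′ g n → ((λ k → c * f k + f′ k) ⊛ g) n ≡ c * (f ⊛ g) n + (f′ ⊛ g) n
⊛-linearˡ c f f′ g zero    =
  solve 4 (λ c x y z → (c :* x :+ y) :* z := c :* (x :* z) :+ y :* z) refl c (f 0) (f′ 0) (g 0)
⊛-linearˡ c f f′ g (suc n) = trans
  (cong (λ s → (c * f 0 + f′ 0) * g (suc n) + s) (⊛-linearˡ c (f ∘ suc) (f′ ∘ suc) g n))
  (solve 6 (λ c x y z u v → (c :* x :+ y) :* z :+ (c :* u :+ v) := c :* (x :* z :+ u) :+ (y :* z :+ v))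
    refl c (f 0) (f′ 0) (g (suc n)) (((f ∘ suc) ⊛ g) n) (((f′ ∘ suc) ⊛ g) n))

⊛-scaleˡ : ∀ c f g n → ((λ k → c * f k) ⊛ g) n ≡ c * (f ⊛ g) n
⊛-scaleˡ c f g zero    = *-assoc c (f 0) (g 0)
⊛-scaleˡ c f g (suc n) = trans
  (cong (λ s → c * f 0 * g (suc n) + s) (⊛-scaleˡ c (f ∘ suc) g n))
  (solve 4 (λ c x z u → c :* x :* z :+ c :* u := c :* (x :* z :+ u))
    refl c (f 0) (g (suc n)) (((f ∘ suc) ⊛ g) n))

⊛-assoc : ∀ f g h n → ((f ⊛ g) ⊛ h) n ≡ (f ⊛ (g ⊛ h)) n
⊛-assoc f g h zero    = *-assoc (f 0) (g 0) (h 0)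
⊛-assoc f g h (suc n) = begin
  f 0 * g 0 * h (suc n) + ((λ k → f 0 * g (suc k) + ((f ∘ suc) ⊛ g) k) ⊛ h) n
    ≡⟨ cong (λ s → f 0 * g 0 * h (suc n) + s) (⊛-linearˡ (f 0) (g ∘ suc) ((f ∘ suc) ⊛ g) h n) ⟩
  f 0 * g 0 * h (suc n) + (f 0 * ((g ∘ suc) ⊛ h) n + (((f ∘ suc) ⊛ g) ⊛ h) n)
    ≡⟨ cong (λ x → f 0 * g 0 * h (suc n) + (f 0 * ((g ∘ suc) ⊛ h) n + x)) (⊛-assoc (f ∘ suc) g h n) ⟩
  f 0 * g 0 * h (suc n) + (f 0 * ((g ∘ suc) ⊛ h) n + ((f ∘ suc) ⊛ (g ⊛ h)) n)
    ≡⟨ solve 5 (λ a b c d e → a :* b :* c :+ (a :* d :+ e) := a :* (b :* c :+ d) :+ e) refl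
         (f 0) (g 0) (h (suc n)) (((g ∘ suc) ⊛ h) n) (((f ∘ suc) ⊛ (g ⊛ h)) n) ⟩
  f 0 * (g 0 * h (suc n) + ((g ∘ suc) ⊛ h) n) + ((f ∘ suc) ⊛ (g ⊛ h)) n ∎
  where open ≡-Reasoning

-- On generating functions θ is z d/dz.
θ : (ℕ → ℚ) → ℕ → ℚ
θ f n = fromℕ n * f n

-- The factor `1ℚ` is kept so that the right side fits `⊛-linearˡ`.
θ-suc : ∀ f n → θ f (suc n) ≡ 1ℚ * f (suc n) + θ (f ∘ suc) n
θ-suc f n = trans (cong (_* f (suc n)) (fromℕ-suc n)) (*-distribʳ-+ (f (suc n)) 1ℚ (fromℕ n))

-- The Leibniz rule for the derivation z d/dz.
θ-⊛ : ∀ f g n → θ (f ⊛ g) n ≡ (θ f ⊛ g) n + (f ⊛ θ g) n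
θ-⊛ f g zero    =
  solve 2 (λ x y → con 0ℚ :* (x :* y) := con 0ℚ :* x :* y :+ x :* (con 0ℚ :* y)) refl (f 0) (g 0)
θ-⊛ f g (suc n) = begin
  fromℕ (suc n) * (x * y + u)
    ≡⟨ solve 4 (λ s x y u → s :* (x :* y :+ u) := x :* (s :* y) :+ s :* u) refl (fromℕ (suc n)) x y u ⟩
  x * θ g (suc n) + fromℕ (suc n) * u
    ≡⟨ cong (λ s → x * θ g (suc n) + s * u) (fromℕ-suc n) ⟩
  x * θ g (suc n) + (1ℚ + fromℕ n) * u
    ≡⟨ cong (λ z → x * θ g (suc n) + z) (*-distribʳ-+ u 1ℚ (fromℕ n)) ⟩
  x * θ g (suc n) + (1ℚ * u + θ (f′ ⊛ g) n)
    ≡⟨ cong (λ z → x * θ g (suc n) + (1ℚ * u + z)) (θ-⊛ f′ g n) ⟩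
  x * θ g (suc n) + (1ℚ * u + ((θ f′ ⊛ g) n + v))
    ≡⟨ solve 5 (λ a o u t v → a :+ (o :* u :+ (t :+ v)) := (o :* u :+ t) :+ (a :+ v)) refl
         (x * θ g (suc n)) 1ℚ u ((θ f′ ⊛ g) n) v ⟩
  (1ℚ * u + (θ f′ ⊛ g) n) + (x * θ g (suc n) + v)
    ≡⟨ cong (_+ (x * θ g (suc n) + v)) (⊛-linearˡ 1ℚ f′ (θ f′) g n) ⟨
  ((λ k → 1ℚ * f′ k + θ f′ k) ⊛ g) n + (x * θ g (suc n) + v)
    ≡⟨ cong (_+ (x * θ g (suc n) + v)) (⊛-cong (θ-suc f) (λ _ → refl) n) ⟨
  ((θ f ∘ suc) ⊛ g) n + (x * θ g (suc n) + v)
    -- The term inserted here is the leading one of `θ f ⊛ g`, which vanishes because `θ f 0` is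
    -- zero.
    ≡⟨ cong (_+ (x * θ g (suc n) + v))
         (solve 3 (λ x y t → t := con 0ℚ :* x :* y :+ t) refl x y (((θ f ∘ suc) ⊛ g) n)) ⟩
  (θ f ⊛ g) (suc n) + (f ⊛ θ g) (suc n) ∎
  where
  open ≡-Reasoning
  f′ = f ∘ suc
  x = f 0
  y = g (suc n)
  u = (f′ ⊛ g) n
  v = (f′ ⊛ θ g) n

-- The coefficients of -log(1 - z).
ℓ : ℕ → ℚ
ℓ zero    = 0ℚ
ℓ (suc j) = recip j

-- `θ ℓ` is the sequence 0, 1, 1, ..., that is z/(1 - z), so `(f ⊛ θ ℓ) n` is the sum of `f j` over
-- j < n.
⊛-θℓ-suc : ∀ f n → (f ⊛ θ ℓ) (suc n) ≡ (f ⊛ θ ℓ) n + f n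
⊛-θℓ-suc f zero = trans (cong (λ x → f 0 * x + f 1 * θ ℓ 0) (recip-inverse 0))
  (solve 2 (λ x y → x :* con 1ℚ :+ y :* con 0ℚ := x :* con 0ℚ :+ x) refl (f 0) (f 1))
⊛-θℓ-suc f (suc n) = begin
  f 0 * θ ℓ (suc (suc n)) + ((f ∘ suc) ⊛ θ ℓ) (suc n)
    ≡⟨ cong₂ (λ x y → f 0 * x + y)
         (trans (recip-inverse (suc n)) (sym (recip-inverse n))) (⊛-θℓ-suc (f ∘ suc) n) ⟩
  f 0 * θ ℓ (suc n) + (((f ∘ suc) ⊛ θ ℓ) n + f (suc n))
    ≡⟨ +-assoc (f 0 * θ ℓ (suc n)) _ _ ⟨
  (f ⊛ θ ℓ) (suc n) + f (suc n) ∎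
  where open ≡-Reasoning

-- The differential equation (1 - z) F′ = q F for F passes to
-- (1 - z) G′ = q G + F for G = -log(1 - z) F.
⊛ℓ-recurrence : ∀ q f → (∀ k → θ f (suc k) ≡ q * f k + θ f k) →
  ∀ k → θ (f ⊛ ℓ) (suc k) ≡ θ (f ⊛ ℓ) k + q * (f ⊛ ℓ) k + f k
⊛ℓ-recurrence q f rec k = begin
  θ (f ⊛ ℓ) (suc k)
    ≡⟨ θ-⊛ f ℓ (suc k) ⟩
  θ f 0 * ℓ (suc k) + ((θ f ∘ suc) ⊛ ℓ) k + (f ⊛ θ ℓ) (suc k)
    ≡⟨ cong₂ (λ x y → θ f 0 * ℓ (suc k) + x + y)
         (trans (⊛-cong rec (λ _ → refl) k) (⊛-linearˡ q f (θ f) ℓ k)) (⊛-θℓ-suc f k) ⟩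
  0ℚ * f 0 * ℓ (suc k) + (q * (f ⊛ ℓ) k + (θ f ⊛ ℓ) k) + ((f ⊛ θ ℓ) k + f k)
    ≡⟨ solve 6 (λ x y s t u a → con 0ℚ :* x :* y :+ (s :+ t) :+ (u :+ a) := t :+ u :+ s :+ a) refl
         (f 0) (ℓ (suc k)) (q * (f ⊛ ℓ) k) ((θ f ⊛ ℓ) k) ((f ⊛ θ ℓ) k) (f k) ⟩
  (θ f ⊛ ℓ) k + (f ⊛ θ ℓ) k + q * (f ⊛ ℓ) k + f k
    ≡⟨ cong (λ x → x + q * (f ⊛ ℓ) k + f k) (θ-⊛ f ℓ k) ⟨
  θ (f ⊛ ℓ) k + q * (f ⊛ ℓ) k + f k ∎
  where open ≡-Reasoning

-- Multiple harmonic-like numbers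

sumOver-filter-map : ∀ {A B : Set} {P : Pred B 0ℓ} (P? : Decidable P) (g : A → B) (f : B → ℚ) xs →
  sumOver (filter P? (map g xs)) f ≡ sumOver (filter (P? ∘ g) xs) (f ∘ g)
sumOver-filter-map P? g f []       = refl
sumOver-filter-map P? g f (x ∷ xs) with does (P? (g x))
... | true  = cong (λ s → f (g x) + s) (sumOver-filter-map P? g f xs)
... | false = sumOver-filter-map P? g f xs

sumOver-*ˡ : ∀ {A : Set} c (f : A → ℚ) xs → sumOver xs (λ x → c * f x) ≡ c * sumOver xs f
sumOver-*ˡ c f []       = sym (*-zeroʳ c)
sumOver-*ˡ c f (x ∷ xs) = trans (cong (λ s → c * f x + s) (sumOver-*ˡ c f xs)) (sym (*-distribˡ-+ c (f x) _))

-- Splitting off the first entry makes the sum over the box an iterated one, so that `boxSum` can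
-- recurse on the tuple length.
sumOver-filter-product : ∀ {m} {P : Pred (Vec ℕ (suc m)) 0ℓ} (P? : Decidable P) xs ys →
  sumOver (filter P? (cartesianProductWith Vec._∷_ xs ys)) tupleRecip
    ≡ sumOver xs (λ x → recip x * sumOver (filter (P? ∘ (x Vec.∷_)) ys) tupleRecip)
sumOver-filter-product P? []       ys = refl
sumOver-filter-product P? (x ∷ xs) ys = begin
  sumOver (filter P? (map (x Vec.∷_) ys ++ zs)) tupleRecip
    ≡⟨ cong (λ l → sumOver l tupleRecip) (filter-++ P? (map (x Vec.∷_) ys) zs) ⟩
  sumOver (filter P? (map (x Vec.∷_) ys) ++ filter P? zs) tupleRecip
    ≡⟨ sumOver-++ tupleRecip (filter P? (map (x Vec.∷_) ys)) (filter P? zs) ⟩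
  sumOver (filter P? (map (x Vec.∷_) ys)) tupleRecip + sumOver (filter P? zs) tupleRecip
    ≡⟨ cong₂ _+_
         (trans (sumOver-filter-map P? (x Vec.∷_) tupleRecip ys)
                (sumOver-*ˡ (recip x) tupleRecip (filter (P? ∘ (x Vec.∷_)) ys)))
         (sumOver-filter-product P? xs ys) ⟩
  sumOver (x ∷ xs) (λ x → recip x * sumOver (filter (P? ∘ (x Vec.∷_)) ys) tupleRecip) ∎
  where
  open ≡-Reasoning
  zs = cartesianProductWith Vec._∷_ xs ys

sumOver-upTo-zero : ∀ N (F : ℕ → ℚ) → (∀ j → F j ≡ 0ℚ) → sumOver (upTo N) F ≡ 0ℚ
sumOver-upTo-zero zero    F F≡0 = refl
sumOver-upTo-zero (suc N) F F≡0 = trans (sumOver-upTo-suc N F)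
  (cong₂ _+_ (F≡0 0) (sumOver-upTo-zero N (F ∘ suc) (F≡0 ∘ suc)))

-- A Cauchy product may be summed over too long a range, provided the excess terms vanish; here `N`
-- comes from the box and `n` from the bound on the tuple sum.
sumOver-upTo-⊛ : ∀ f g n N → n ℕ.≤ N → (F : ℕ → ℚ) →
  (∀ j → j ℕ.≤ n → F j ≡ f j * g (n ∸ j)) → (∀ j → n ℕ.< j → F j ≡ 0ℚ) →
  sumOver (upTo (suc N)) F ≡ (f ⊛ g) n
sumOver-upTo-⊛ f g zero N _ F low high = trans (sumOver-upTo-suc N F)
  (trans (cong₂ _+_ (low 0 ℕ.z≤n) (sumOver-upTo-zero N (F ∘ suc) (λ j → high (suc j) (ℕ.s≤s ℕ.z≤n))))
         (+-identityʳ _))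
sumOver-upTo-⊛ f g (suc n) (suc N) (ℕ.s≤s n≤N) F low high = trans (sumOver-upTo-suc (suc N) F)
  (cong₂ _+_ (low 0 ℕ.z≤n)
    (sumOver-upTo-⊛ (f ∘ suc) g n N n≤N (F ∘ suc)
      (λ j j≤n → low (suc j) (ℕ.s≤s j≤n)) (λ j n<j → high (suc j) (ℕ.s≤s n<j))))

-- The coefficients of (-log(1 - z))^m / (1 - z).
h : ℕ → ℕ → ℚ
h zero    n = 1ℚ
h (suc m)   = ℓ ⊛ h m

-- Choosing the first entry lowers the bound on the remaining sum but leaves the box unchanged, so
-- the side `N` and the bound `n` must be independent for the induction.
boxSum : ∀ N n m → n ℕ.≤ N →
  sumOver (filter (λ js → tupleSum js ℕ.≤? n) (tuples m (upTo N))) tupleRecip ≡ h m n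
boxSum N n zero _ = refl
boxSum N zero (suc m) _ = trans
  (cong (λ l → sumOver l tupleRecip)
    -- A nonempty tuple of positive integers never has sum 0; on the right, `ℓ 0` is zero.
    (filter-none (λ js → tupleSum js ℕ.≤? 0) (universal (λ { (_ Vec.∷ _) () }) (tuples (suc m) (upTo N)))))
  (sym (*-zeroˡ (h m 0)))
boxSum (suc N) (suc n) (suc m) (ℕ.s≤s n≤N) = begin
  sumOver (filter (λ js → tupleSum js ℕ.≤? suc n) (tuples (suc m) (upTo (suc N)))) tupleRecip
    ≡⟨ sumOver-filter-product (λ js → tupleSum js ℕ.≤? suc n) (upTo (suc N)) ts ⟩
  sumOver (upTo (suc N)) F
    ≡⟨ sumOver-upTo-⊛ recip (h m) n N n≤N F
         (λ j j≤n → cong (recip j *_) (low j j≤n))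
         (λ j n<j → trans (cong (recip j *_) (high j n<j)) (*-zeroʳ (recip j))) ⟩
  (recip ⊛ h m) n
    -- `ℓ ∘ suc` is `recip` and `ℓ 0` is zero, which accounts for the shift from `n` to `suc n`.
    ≡⟨ solve 2 (λ x y → x := con 0ℚ :* y :+ x) refl ((recip ⊛ h m) n) (h m (suc n)) ⟩
  (ℓ ⊛ h m) (suc n) ∎
  where
  open ≡-Reasoning
  ts = tuples m (upTo (suc N))

  inner : ℕ → ℚ
  inner j = sumOver (filter (λ js → suc (j ℕ.+ tupleSum js) ℕ.≤? suc n) ts) tupleRecip

  F : ℕ → ℚ
  F j = recip j * inner j

  low : ∀ j → j ℕ.≤ n → inner j ≡ h m (n ∸ j)
  low j j≤n = trans
    (cong (λ l → sumOver l tupleRecip)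
      (filter-≐ (λ js → suc (j ℕ.+ tupleSum js) ℕ.≤? suc n) (λ js → tupleSum js ℕ.≤? n ∸ j)
        ( (λ {js} le → ℕ.m+n≤o⇒m≤o∸n (tupleSum js)
            (subst (ℕ._≤ n) (ℕ.+-comm j (tupleSum js)) (ℕ.≤-pred le)))
        , (λ {js} le → ℕ.s≤s (subst (ℕ._≤ n) (ℕ.+-comm (tupleSum js) j)
            (ℕ.m≤o∸n⇒m+n≤o (tupleSum js) j≤n le))))
        ts))
    (boxSum (suc N) (n ∸ j) m (ℕ.≤-trans (ℕ.m∸n≤m n j) (ℕ.m≤n⇒m≤1+n n≤N)))

  high : ∀ j → n ℕ.< j → inner j ≡ 0ℚ
  high j n<j = cong (λ l → sumOver l tupleRecip)
    (filter-none (λ js → suc (j ℕ.+ tupleSum js) ℕ.≤? suc n)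
      (universal (λ js le → ℕ.<⇒≱ n<j (ℕ.m+n≤o⇒m≤o j (ℕ.≤-pred le))) ts))

H≡h : ∀ n m → H n m ≡ h m n
H≡h n zero    = refl
H≡h n (suc m) = trans
  (cong (λ l → sumOver l tupleRecip)
    (filter-≐ (λ js → (1 ℕ.≤? tupleSum js) ×-dec (tupleSum js ℕ.≤? n)) (λ js → tupleSum js ℕ.≤? n)
      (proj₂ , λ { {_ Vec.∷ _} le → ℕ.s≤s ℕ.z≤n , le })
      (tuples (suc m) (upTo n))))
  (boxSum n n (suc m) ℕ.≤-refl)

harmonic≡h₁ : ∀ n → harmonic n ≡ h 1 n
harmonic≡h₁ zero    = refl
harmonic≡h₁ (suc n) = begin
  sumOver (upTo (suc n)) recip       ≡⟨ sumOver-cong (λ j → sym (*-identityʳ (recip j))) (upTo (suc n)) ⟩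
  ∑[0≤ j ≤ n ] (recip j * 1ℚ)        ≡⟨ ⊛-∑ recip (h 0) n ⟩
  (recip ⊛ h 0) n                    ≡⟨ +-identityˡ _ ⟨
  h 1 (suc n)                        ∎
  where open ≡-Reasoning

-- The weights and their recurrences.

-- The coefficients of binom(2p, p) (1 - z)^(-p - 1/2).
A : ℕ → ℕ → ℚ
A p k = 1/2^ (2 ℕ.* k) * fromℕ (central (k ℕ.+ p)) * fromℕ ((k ℕ.+ p) C k)

odd : ℕ → ℚ
odd n = fromℕ 2 * fromℕ n + 1ℚ

fromℕ-odd : ∀ n → fromℕ (suc (2 ℕ.* n)) ≡ odd n
fromℕ-odd n = trans (fromℕ-suc (2 ℕ.* n)) (trans (+-comm 1ℚ (fromℕ (2 ℕ.* n))) (cong (_+ 1ℚ) (fromℕ-homo-* 2 n)))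

odd-recip : ∀ n → odd n * recip (2 ℕ.* n) ≡ 1ℚ
odd-recip n = trans (cong (_* recip (2 ℕ.* n)) (sym (fromℕ-odd n))) (recip-inverse (2 ℕ.* n))

fromℕ-central-suc : ∀ n → fromℕ (suc n) * fromℕ (central (suc n)) ≡ fromℕ 2 * (odd n * fromℕ (central n))
fromℕ-central-suc n = begin
  fromℕ (suc n) * fromℕ (central (suc n))             ≡⟨ fromℕ-homo-* (suc n) (central (suc n)) ⟨
  fromℕ (suc n ℕ.* central (suc n))                   ≡⟨ cong fromℕ (central-suc n) ⟩
  fromℕ (2 ℕ.* (suc (2 ℕ.* n) ℕ.* central n))         ≡⟨ fromℕ-homo-* 2 (suc (2 ℕ.* n) ℕ.* central n) ⟩
  fromℕ 2 * fromℕ (suc (2 ℕ.* n) ℕ.* central n)       ≡⟨ cong (fromℕ 2 *_) (fromℕ-homo-* (suc (2 ℕ.* n)) (central n)) ⟩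
  fromℕ 2 * (fromℕ (suc (2 ℕ.* n)) * fromℕ (central n))
    ≡⟨ cong (λ x → fromℕ 2 * (x * fromℕ (central n))) (fromℕ-odd n) ⟩
  fromℕ 2 * (odd n * fromℕ (central n))               ∎
  where open ≡-Reasoning

fromℕ-*-≡ : ∀ a b c d → a ℕ.* b ≡ c ℕ.* d → fromℕ a * fromℕ b ≡ fromℕ c * fromℕ d
fromℕ-*-≡ a b c d eq = trans (sym (fromℕ-homo-* a b)) (trans (cong fromℕ eq) (fromℕ-homo-* c d))

1/2^-even-suc : ∀ k → 1/2^ (2 ℕ.* suc k) ≡ ½ * (½ * 1/2^ (2 ℕ.* k))
1/2^-even-suc k = trans (cong 1/2^_ (ℕ.*-suc 2 k))
  (trans (1/2^-suc (suc (2 ℕ.* k))) (cong (½ *_) (1/2^-suc (2 ℕ.* k))))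

-- Absorption trades `suc k` for `suc (k ℕ.+ p)`, which `central-suc` consumes; its factor 2 against
-- the quarter from the power of two leaves `½`.
A-suc : ∀ p k → θ (A p) (suc k) ≡ ½ * odd (k ℕ.+ p) * A p k
A-suc p k = begin
  fromℕ (suc k) * (1/2^ (2 ℕ.* suc k) * c′ * b′)
    ≡⟨ cong (λ x → fromℕ (suc k) * (x * c′ * b′)) (1/2^-even-suc k) ⟩
  fromℕ (suc k) * (½ * (½ * w) * c′ * b′)
    ≡⟨ solve 4 (λ s w c b → s :* (con ½ :* (con ½ :* w) :* c :* b) := con ½ :* (con ½ :* w) :* c :* (s :* b))
         refl (fromℕ (suc k)) w c′ b′ ⟩
  ½ * (½ * w) * c′ * (fromℕ (suc k) * b′)
    ≡⟨ cong (½ * (½ * w) * c′ *_)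
         (fromℕ-*-≡ (suc k) (suc N C suc k) (suc N) (N C k) (absorption N k)) ⟩
  ½ * (½ * w) * c′ * (fromℕ (suc N) * b)
    ≡⟨ solve 4 (λ s w c b → con ½ :* (con ½ :* w) :* c :* (s :* b) := con ½ :* (con ½ :* w) :* (s :* c) :* b)
         refl (fromℕ (suc N)) w c′ b ⟩
  ½ * (½ * w) * (fromℕ (suc N) * c′) * b
    ≡⟨ cong (λ x → ½ * (½ * w) * x * b) (fromℕ-central-suc N) ⟩
  ½ * (½ * w) * (fromℕ 2 * (odd N * c)) * b
    ≡⟨ solve 4 (λ w o c b → con ½ :* (con ½ :* w) :* (con (fromℕ 2) :* (o :* c)) :* b := con ½ :* o :* (w :* c :* b))
         refl w (odd N) c b ⟩
  ½ * odd N * (w * c * b) ∎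
  where
  open ≡-Reasoning
  N = k ℕ.+ p
  w = 1/2^ (2 ℕ.* k)
  c = fromℕ (central N)
  c′ = fromℕ (central (suc N))
  b = fromℕ (N C k)
  b′ = fromℕ (suc N C suc k)

-- The same computation in the direction of `p`. The factor `odd (k ℕ.+ p)` is again the one in
-- `A-suc`, so the two neighbours of `A p k` can be compared.
A-shift : ∀ p k → fromℕ (suc p) * A (suc p) k ≡ fromℕ 2 * odd (k ℕ.+ p) * A p k
A-shift p k = begin
  fromℕ (suc p) * (w * fromℕ (central (k ℕ.+ suc p)) * b′)
    ≡⟨ cong (λ x → fromℕ (suc p) * (w * fromℕ (central x) * b′)) (ℕ.+-suc k p) ⟩
  fromℕ (suc p) * (w * c′ * b′)
    ≡⟨ solve 4 (λ s w c b → s :* (w :* c :* b) := w :* c :* (s :* b)) refl (fromℕ (suc p)) w c′ b′ ⟩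
  w * c′ * (fromℕ (suc p) * b′)
    ≡⟨ cong (w * c′ *_)
         (fromℕ-*-≡ (suc p) ((k ℕ.+ suc p) C k) (suc N) (N C k) (absorption-lower k p)) ⟩
  w * c′ * (fromℕ (suc N) * b)
    ≡⟨ solve 4 (λ s w c b → w :* c :* (s :* b) := w :* (s :* c) :* b) refl (fromℕ (suc N)) w c′ b ⟩
  w * (fromℕ (suc N) * c′) * b
    ≡⟨ cong (λ x → w * x * b) (fromℕ-central-suc N) ⟩
  w * (fromℕ 2 * (odd N * c)) * b
    ≡⟨ solve 5 (λ t w o c b → w :* (t :* (o :* c)) :* b := t :* o :* (w :* c :* b))
         refl (fromℕ 2) w (odd N) c b ⟩
  fromℕ 2 * odd N * (w * c * b) ∎
  where
  open ≡-Reasoning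
  N = k ℕ.+ p
  w = 1/2^ (2 ℕ.* k)
  c = fromℕ (central N)
  c′ = fromℕ (central (suc N))
  b = fromℕ (N C k)
  b′ = fromℕ ((k ℕ.+ suc p) C k)

½odd-+ : ∀ k p → ½ * odd (k ℕ.+ p) ≡ (fromℕ p + ½) + fromℕ k
½odd-+ k p = trans (cong (λ x → ½ * (fromℕ 2 * x + 1ℚ)) (fromℕ-homo-+ k p))
  (solve 2 (λ κ π → con ½ :* (con (fromℕ 2) :* (κ :+ π) :+ con 1ℚ) := (π :+ con ½) :+ κ) refl (fromℕ k) (fromℕ p))

-- The coefficient form of (1 - z) F′ = (p + 1/2) F.
A-recurrence : ∀ p k → θ (A p) (suc k) ≡ (fromℕ p + ½) * A p k + θ (A p) k
A-recurrence p k = trans (A-suc p k)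
  (trans (cong (_* A p k) (½odd-+ k p)) (*-distribʳ-+ (A p k) (fromℕ p + ½) (fromℕ k)))

-- Weights times differences of odd harmonic numbers.

O-suc : ∀ n → O (suc n) ≡ O n + recip (2 ℕ.* n)
O-suc n = sumOver-upTo-last n (λ j → recip (2 ℕ.* j))

D : ℕ → ℕ → ℚ
D p k = O (k ℕ.+ p) - O p

D-suc : ∀ p k → D p (suc k) ≡ D p k + recip (2 ℕ.* (k ℕ.+ p))
D-suc p k = trans (cong (_- O p) (O-suc (k ℕ.+ p)))
  (solve 3 (λ x r y → x :+ r :- y := x :- y :+ r) refl (O (k ℕ.+ p)) (recip (2 ℕ.* (k ℕ.+ p))) (O p))

B : ℕ → ℕ → ℚ
B p k = A p k * D p k

B-zero : ∀ p → B p 0 ≡ 0ℚ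
B-zero p = trans (cong (A p 0 *_) (+-inverseʳ (O p))) (*-zeroʳ (A p 0))

-- The odd factor in `A-suc` cancels the denominator of the fraction that `D` gains, leaving the
-- inhomogeneous term `½ * A p k`.
B-recurrence : ∀ p k → θ (B p) (suc k) ≡ θ (B p) k + (fromℕ p + ½) * B p k + ½ * A p k
B-recurrence p k = begin
  fromℕ (suc k) * (A p (suc k) * D p (suc k))
    ≡⟨ *-assoc (fromℕ (suc k)) (A p (suc k)) (D p (suc k)) ⟨
  θ (A p) (suc k) * D p (suc k)
    ≡⟨ cong₂ _*_ (A-suc p k) (D-suc p k) ⟩
  ½ * o * a * (d + r)
    ≡⟨ solve 5 (λ c o a d r → c :* o :* a :* (d :+ r) := c :* o :* (a :* d) :+ c :* (o :* r) :* a) refl ½ o a d r ⟩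
  ½ * o * (a * d) + ½ * (o * r) * a
    ≡⟨ cong₂ (λ x y → x * (a * d) + ½ * y * a) (½odd-+ k p) (odd-recip (k ℕ.+ p)) ⟩
  (q + fromℕ k) * (a * d) + ½ * 1ℚ * a
    ≡⟨ solve 4 (λ q κ b a → (q :+ κ) :* b :+ con ½ :* con 1ℚ :* a := κ :* b :+ q :* b :+ con ½ :* a)
         refl q (fromℕ k) (a * d) a ⟩
  fromℕ k * (a * d) + q * (a * d) + ½ * a ∎
  where
  open ≡-Reasoning
  o = odd (k ℕ.+ p)
  a = A p k
  d = D p k
  r = recip (2 ℕ.* (k ℕ.+ p))
  q = fromℕ p + ½

-- Both sides vanish at 0 and obey the same first-order recurrence, by `B-recurrence` and
-- `⊛ℓ-recurrence`; its leading coefficient `fromℕ (suc k)` can be cancelled.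
B≡½A⊛ℓ : ∀ p k → B p k ≡ ½ * (A p ⊛ ℓ) k
B≡½A⊛ℓ p zero    = trans (B-zero p)
  (solve 1 (λ a → con 0ℚ := con ½ :* (a :* con 0ℚ)) refl (A p 0))
B≡½A⊛ℓ p (suc k) = fromℕ-cancelˡ k (begin
  θ (B p) (suc k)
    ≡⟨ B-recurrence p k ⟩
  fromℕ k * B p k + q * B p k + ½ * A p k
    ≡⟨ cong (λ b → fromℕ k * b + q * b + ½ * A p k) (B≡½A⊛ℓ p k) ⟩
  fromℕ k * (½ * s) + q * (½ * s) + ½ * A p k
    ≡⟨ solve 5 (λ c κ q s a → κ :* (c :* s) :+ q :* (c :* s) :+ c :* a := c :* (κ :* s :+ q :* s :+ a))
         refl ½ (fromℕ k) q s (A p k) ⟩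
  ½ * (θ (A p ⊛ ℓ) k + q * s + A p k)
    ≡⟨ cong (½ *_) (⊛ℓ-recurrence q (A p) (A-recurrence p) k) ⟨
  ½ * (fromℕ (suc k) * (A p ⊛ ℓ) (suc k))
    ≡⟨ solve 3 (λ c κ s → c :* (κ :* s) := κ :* (c :* s)) refl ½ (fromℕ (suc k)) ((A p ⊛ ℓ) (suc k)) ⟩
  fromℕ (suc k) * (½ * (A p ⊛ ℓ) (suc k)) ∎)
  where
  open ≡-Reasoning
  q = fromℕ p + ½
  s = (A p ⊛ ℓ) k

-- The first identity.

-- `h (suc m)` unfolds to `ℓ ⊛ h m`, so reassociating moves the logarithm from the weights to the
-- harmonic factor.
B⊛h : ∀ p m n → (B p ⊛ h m) n ≡ ½ * (A p ⊛ h (suc m)) n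
B⊛h p m n = begin
  (B p ⊛ h m) n                            ≡⟨ ⊛-cong (B≡½A⊛ℓ p) (λ _ → refl) n ⟩
  ((λ k → ½ * (A p ⊛ ℓ) k) ⊛ h m) n        ≡⟨ ⊛-scaleˡ ½ (A p ⊛ ℓ) (h m) n ⟩
  ½ * ((A p ⊛ ℓ) ⊛ h m) n                  ≡⟨ cong (½ *_) (⊛-assoc (A p) ℓ (h m) n) ⟩
  ½ * (A p ⊛ h (suc m)) n                  ∎
  where open ≡-Reasoning

∑-A*H : ∀ p m n → ∑[0≤ k ≤ n ] (A p k * H (n ∸ k) m) ≡ (A p ⊛ h m) n
∑-A*H p m n = trans
  (sumOver-cong (λ k → cong (A p k *_) (H≡h (n ∸ k) m)) (upTo (suc n)))
  (⊛-∑ (A p) (h m) n)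

∑-A*H*D : ∀ n p m →
  ∑[0≤ k ≤ n ] (A p k * H (n ∸ k) m * D p k) ≡ ½ * (∑[0≤ k ≤ n ] (A p k * H (n ∸ k) (m ℕ.+ 1)))
∑-A*H*D n p m = begin
  ∑[0≤ k ≤ n ] (A p k * H (n ∸ k) m * D p k)
    ≡⟨ sumOver-cong (λ k → trans (cong (λ x → A p k * x * D p k) (H≡h (n ∸ k) m))
         (solve 3 (λ a x d → a :* x :* d := a :* d :* x) refl (A p k) (h m (n ∸ k)) (D p k)))
         (upTo (suc n)) ⟩
  ∑[0≤ k ≤ n ] (B p k * h m (n ∸ k))
    ≡⟨ ⊛-∑ (B p) (h m) n ⟩
  (B p ⊛ h m) n
    ≡⟨ B⊛h p m n ⟩
  ½ * (A p ⊛ h (suc m)) n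
    ≡⟨ cong (λ i → ½ * (A p ⊛ h i) n) (ℕ.+-comm 1 m) ⟩
  ½ * (A p ⊛ h (m ℕ.+ 1)) n
    ≡⟨ cong (½ *_) (∑-A*H p (m ℕ.+ 1) n) ⟨
  ½ * (∑[0≤ k ≤ n ] (A p k * H (n ∸ k) (m ℕ.+ 1))) ∎
  where open ≡-Reasoning

-- Telescoping and the second identity.

D-shift : ∀ p n → D p (suc n) ≡ D (suc p) n + recip (2 ℕ.* p)
D-shift p n = begin
  O (suc (n ℕ.+ p)) - O p
    ≡⟨ solve 3 (λ x y u → x :- y := x :- (y :+ u) :+ u) refl (O (suc (n ℕ.+ p))) (O p) u ⟩
  O (suc (n ℕ.+ p)) - (O p + u) + u
    ≡⟨ cong₂ (λ N y → O N - y + u) (ℕ.+-suc n p) (O-suc p) ⟨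
  D (suc p) n + u ∎
  where
  open ≡-Reasoning
  u = recip (2 ℕ.* p)

-- The right side is (p + 1)/(2p + 1) times `B (suc p) n`. Induction on `n` checks that its
-- increment is `fromℕ 2 * B p (suc n)`.
∑-B : ∀ p n → fromℕ 2 * (∑[0≤ k ≤ n ] B p k) ≡ recip (2 ℕ.* p) * (fromℕ (suc p) * A (suc p) n) * D (suc p) n
∑-B p zero = begin
  fromℕ 2 * (B p 0 + 0ℚ)
    ≡⟨ cong (λ x → fromℕ 2 * (x + 0ℚ)) (B-zero p) ⟩
  0ℚ
    ≡⟨ *-zeroʳ (u * (fromℕ (suc p) * A (suc p) 0)) ⟨
  u * (fromℕ (suc p) * A (suc p) 0) * 0ℚ
    ≡⟨ cong (u * (fromℕ (suc p) * A (suc p) 0) *_) (+-inverseʳ (O (suc p))) ⟨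
  u * (fromℕ (suc p) * A (suc p) 0) * D (suc p) 0 ∎
  where
  open ≡-Reasoning
  u = recip (2 ℕ.* p)
∑-B p (suc n) = begin
  fromℕ 2 * (∑[0≤ k ≤ suc n ] B p k)
    ≡⟨ cong (fromℕ 2 *_) (sumOver-upTo-last (suc n) (B p)) ⟩
  fromℕ 2 * ((∑[0≤ k ≤ n ] B p k) + a * D p (suc n))
    ≡⟨ *-distribˡ-+ (fromℕ 2) (∑[0≤ k ≤ n ] B p k) (a * D p (suc n)) ⟩
  fromℕ 2 * (∑[0≤ k ≤ n ] B p k) + fromℕ 2 * (a * D p (suc n))
    ≡⟨ cong₂ (λ x y → x + fromℕ 2 * (a * y)) (∑-B p n) (D-shift p n) ⟩
  u * (fromℕ (suc p) * A (suc p) n) * d + fromℕ 2 * (a * (d + u))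
    ≡⟨ cong (λ x → u * x * d + fromℕ 2 * (a * (d + u))) shifted ⟩
  u * (fromℕ 4 * (s * a)) * d + fromℕ 2 * (a * (d + u))
    ≡⟨ solve 4 (λ u s a d → u :* (con (fromℕ 4) :* (s :* a)) :* d :+ con (fromℕ 2) :* (a :* (d :+ u))
                  := con (fromℕ 2) :* a :* ((con (fromℕ 2) :* s :* u :+ con 1ℚ) :* d :+ u :* con 1ℚ))
         refl u s a d ⟩
  fromℕ 2 * a * ((fromℕ 2 * s * u + 1ℚ) * d + u * 1ℚ)
    -- The coefficient of `d` is `u * o`, and the remaining 1 is written as `o * v`; then `o`
    -- factors out and leaves `d + v`, the next value of `D (suc p)`.
    ≡⟨ cong₂ (λ x y → fromℕ 2 * a * (x * d + u * y)) u*o (odd-recip (n ℕ.+ suc p)) ⟨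
  fromℕ 2 * a * (u * o * d + u * (o * v))
    ≡⟨ solve 6 (λ t u o a d v → t :* a :* (u :* o :* d :+ u :* (o :* v)) := u :* (t :* o :* a) :* (d :+ v))
         refl (fromℕ 2) u o a d v ⟩
  u * (fromℕ 2 * o * a) * (d + v)
    ≡⟨ cong (λ N → u * (fromℕ 2 * odd N * a) * (d + v)) (ℕ.+-suc n p) ⟩
  u * (fromℕ 2 * odd (suc n ℕ.+ p) * a) * (d + v)
    ≡⟨ cong₂ (λ x y → u * x * y) (A-shift p (suc n)) (D-suc (suc p) n) ⟨
  u * (fromℕ (suc p) * A (suc p) (suc n)) * D (suc p) (suc n) ∎
  where
  open ≡-Reasoning
  u = recip (2 ℕ.* p)
  a = A p (suc n)
  d = D (suc p) n
  s = fromℕ (suc n)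
  o = odd (n ℕ.+ suc p)
  v = recip (2 ℕ.* (n ℕ.+ suc p))

  -- On series this is (p + 1) F_{p+1} = 4 F_p′, where F_p is the series of `A p`.
  shifted : fromℕ (suc p) * A (suc p) n ≡ fromℕ 4 * (s * a)
  shifted = begin
    fromℕ (suc p) * A (suc p) n
      ≡⟨ A-shift p n ⟩
    fromℕ 2 * odd (n ℕ.+ p) * A p n
      ≡⟨ solve 2 (λ o a → con (fromℕ 2) :* o :* a := con (fromℕ 4) :* (con ½ :* o :* a)) refl (odd (n ℕ.+ p)) (A p n) ⟩
    fromℕ 4 * (½ * odd (n ℕ.+ p) * A p n)
      ≡⟨ cong (fromℕ 4 *_) (A-suc p n) ⟨
    fromℕ 4 * (s * a) ∎

  -- 2(n + p + 1) + 1 = 2(n + 1) + (2p + 1), and `u` is the reciprocal of 2p + 1.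
  u*o : u * o ≡ fromℕ 2 * s * u + 1ℚ
  u*o = begin
    u * odd (n ℕ.+ suc p)
      ≡⟨ cong (λ N → u * odd N) (ℕ.+-suc n p) ⟩
    u * odd (suc n ℕ.+ p)
      ≡⟨ cong (λ x → u * (fromℕ 2 * x + 1ℚ)) (fromℕ-homo-+ (suc n) p) ⟩
    u * (fromℕ 2 * (s + fromℕ p) + 1ℚ)
      ≡⟨ solve 4 (λ u t s π → u :* (t :* (s :+ π) :+ con 1ℚ) := t :* s :* u :+ (t :* π :+ con 1ℚ) :* u)
           refl u (fromℕ 2) s (fromℕ p) ⟩
    fromℕ 2 * s * u + odd p * u
      ≡⟨ cong (λ x → fromℕ 2 * s * u + x) (odd-recip p) ⟩
    fromℕ 2 * s * u + 1ℚ ∎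

∑-A*harmonic : ∀ n p → ∑[0≤ k ≤ n ] (A p k * harmonic (n ∸ k))
  ≡ 1/2^ (2 ℕ.* n) * (+ suc p / suc (2 ℕ.* p))
      * fromℕ (central (n ℕ.+ suc p)) * fromℕ ((n ℕ.+ suc p) C n) * D (suc p) n
∑-A*harmonic n p = begin
  ∑[0≤ k ≤ n ] (A p k * harmonic (n ∸ k))
    ≡⟨ sumOver-cong (λ k → cong (A p k *_) (harmonic≡h₁ (n ∸ k))) (upTo (suc n)) ⟩
  ∑[0≤ k ≤ n ] (A p k * h 1 (n ∸ k))
    ≡⟨ ⊛-∑ (A p) (h 1) n ⟩
  (A p ⊛ h 1) n
    -- The factor `½` is created so that `B⊛h` can be read backwards at m = 0; as `h 0` is
    -- constantly 1, a plain sum of `B p` remains.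
    ≡⟨ solve 1 (λ x → x := con (fromℕ 2) :* (con ½ :* x)) refl ((A p ⊛ h 1) n) ⟩
  fromℕ 2 * (½ * (A p ⊛ h 1) n)
    ≡⟨ cong (fromℕ 2 *_) (B⊛h p 0 n) ⟨
  fromℕ 2 * (B p ⊛ h 0) n
    ≡⟨ cong (fromℕ 2 *_) (⊛-∑ (B p) (h 0) n) ⟨
  fromℕ 2 * (∑[0≤ k ≤ n ] (B p k * 1ℚ))
    ≡⟨ cong (fromℕ 2 *_) (sumOver-cong (λ k → *-identityʳ (B p k)) (upTo (suc n))) ⟩
  fromℕ 2 * (∑[0≤ k ≤ n ] B p k)
    ≡⟨ ∑-B p n ⟩
  u * (s * (w * c * b)) * d
    ≡⟨ solve 6 (λ u s w c b d → u :* (s :* (w :* c :* b)) :* d := w :* (s :* u) :* c :* b :* d) refl u s w c b d ⟩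
  w * (s * u) * c * b * d
    ≡⟨ cong (λ x → w * x * c * b * d) (/-recip (+ suc p) (2 ℕ.* p)) ⟨
  w * (+ suc p / suc (2 ℕ.* p)) * c * b * d ∎
  where
  open ≡-Reasoning
  u = recip (2 ℕ.* p)
  s = fromℕ (suc p)
  w = 1/2^ (2 ℕ.* n)
  c = fromℕ (central (n ℕ.+ suc p))
  b = fromℕ ((n ℕ.+ suc p) C n)
  d = D (suc p) n

theorem13 : ((n p m : ℕ) →
    ∑[0≤ k ≤ n ] (1/2^ (2 ℕ.* k) * fromℕ ((2 ℕ.* (k ℕ.+ p)) C (k ℕ.+ p)) * fromℕ ((k ℕ.+ p) C k)
    * H (n ∸ k) m * (O (k ℕ.+ p) - O p))
    ≡ ½ * (∑[0≤ k ≤ n ] (1/2^ (2 ℕ.* k) * fromℕ ((2 ℕ.* (k ℕ.+ p)) C (k ℕ.+ p)) * fromℕ ((k ℕ.+ p) C k)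
    * H (n ∸ k) (m ℕ.+ 1))))
    ×
    ((n p : ℕ) →
    ∑[0≤ k ≤ n ] (1/2^ (2 ℕ.* k) * fromℕ ((2 ℕ.* (k ℕ.+ p)) C (k ℕ.+ p)) * fromℕ ((k ℕ.+ p) C k)
    * harmonic (n ∸ k))
    ≡ 1/2^ (2 ℕ.* n) * (+ (p ℕ.+ 1) / suc (2 ℕ.* p))
    * fromℕ ((2 ℕ.* (n ℕ.+ p ℕ.+ 1)) C (n ℕ.+ p ℕ.+ 1)) * fromℕ ((n ℕ.+ p ℕ.+ 1) C n)
    * (O (n ℕ.+ p ℕ.+ 1) - O (p ℕ.+ 1)))
theorem13 = ∑-A*H*D , λ n p →
  trans (∑-A*harmonic n p)
    (cong₂ (λ q N → 1/2^ (2 ℕ.* n) * (+ q / suc (2 ℕ.* p))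
                      * fromℕ (central N) * fromℕ (N C n) * (O N - O q))
      (ℕ.+-comm 1 p)
      (trans (cong (n ℕ.+_) (ℕ.+-comm 1 p)) (sym (ℕ.+-assoc n p 1))))
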